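{- There is a $2,2$-perfect graph $G$ such that $G^2$ is not perfect.
   Context: All graphs are simple and undirected with nonempty vertex set. $G^2$ is the square of $G$: the graph on $V(G)$ in which two distinct vertices are adjacent if and only if their distance in $G$ is at most $2$. A graph is perfect if $\chi(H)=\omega(H)$ (usual chromatic and clique numbers) for every induced subgraph $H$. A shortest path in a graph $G$ is a path between some vertices $u,v$ whose length (number of edges) equals the graph distance between $u$ and $v$. A set $S\subseteq V(G)$ is $k,d$-independent in $G$ if every shortest path in $G$ of length at most $d$ contains fewer than $k$ vertices of $S$. The $k,d$-chromatic number $\chi^k_d(G)$ is the least positive integer $c$ such that some coloring $V(G)\to\{1,\dots,c\}$ has all color classes $k,d$-independent. A set $S\subseteq V(G)$ is a $k,d$-clique in $G$ if every $k$-element subset of $S$ is contained in some shortest path of $G$ of length at most $d$; $\omega^k_d(G)$ is the supremum of the sizes of $k,d$-cliques in $G$. For $2\le k\le d+1$, $G$ is $k,d$-perfect if $\chi^k_d(H)=\left\lceil\frac{\omega^k_d(H)}{k-1}\right\rceil$ for every induced subgraph $H$ of $G$ (shortest paths being computed in $H$). -}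

module Defs where

open import Data.Fin using (Fin; zero; suc; inject₁; fromℕ; opposite)
open import Data.Fin.Properties using (_≟_; any?; opposite-involutive)
open import Data.Fin.Subset using (Subset; _∈_; _⊆_; _∩_; ∣_∣)
open import Data.Integer using (+_)
open import Data.Nat using (ℕ; zero; suc; _∸_; _≤_; _<_; _≤?_; s≤s; NonZero)
open import Data.Product using (Σ-syntax; ∃-syntax; _×_; _,_)
open import Data.Rational.Unnormalised using (_/_; ceiling)
open import Data.Vec using (tabulate)
open import Function.Definitions using (Injective)
open import Function.Bundles using (_⇔_)
open import Relation.Binary.PropositionalEquality using (_≡_; _≢_; refl; sym; trans; cong; subst; ≢-sym)
open import Relation.Nullary using (¬_; does)
open import Relation.Nullary.Decidable using (True; toWitness)

-- Graphs are finite, simple, undirected and nonempty; the vertices are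
-- labelled by Fin order.  Adj need not be decidable.
record Graph : Set₁ where
  field
    order    : ℕ
    nonempty : NonZero order
  Vertex : Set
  Vertex = Fin order
  field
    Adj     : Vertex → Vertex → Set
    symm    : ∀ {u v} → Adj u v → Adj v u
    irrefl  : ∀ {v} → ¬ Adj v v

open Graph public using (Vertex; order)

-- H is an induced subgraph of G up to relabelling: the image of embed is the
-- vertex set of the subgraph.
record InducedSubgraph (H G : Graph) : Set where
  field
    embed     : Vertex H → Vertex G
    injective : Injective _≡_ _≡_ embed
    induced   : ∀ u v → Graph.Adj H u v ⇔ Graph.Adj G (embed u) (embed v)

module _ (G : Graph) where
  open Graph G using (Adj)

  record Path (u v : Vertex G) (ℓ : ℕ) : Set where
    field
      vertex   : Fin (suc ℓ) → Vertex G
      start    : vertex zero ≡ u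
      end      : vertex (fromℕ ℓ) ≡ v
      adjacent : ∀ (i : Fin ℓ) → Adj (vertex (inject₁ i)) (vertex (suc i))
      distinct : Injective _≡_ _≡_ vertex

  -- A relation rather than a function: vertices in different components
  -- have no (finite) distance.
  IsDistance : Vertex G → Vertex G → ℕ → Set
  IsDistance u v m = Path u v m × (∀ {ℓ} → Path u v ℓ → m ≤ ℓ)

  -- The least-length conjunct of IsDistance is what makes path shortest.
  record ShortestPath≤ (d : ℕ) : Set where
    field
      {u v}    : Vertex G
      length   : ℕ
      path     : Path u v length
      shortest : IsDistance u v length
      bounded  : length ≤ d

    vertices : Subset (order G)
    vertices = tabulate λ w → does (any? λ i → Path.vertex path i ≟ w)

  open ShortestPath≤ public using (vertices)

  colorClass : ∀ {c} → (Vertex G → Fin c) → Fin c → Subset (order G)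
  colorClass f i = tabulate λ v → does (f v ≟ i)

  KDIndependent : (k d : ℕ) → Subset (order G) → Set
  KDIndependent k d S = ∀ (p : ShortestPath≤ d) → ∣ S ∩ vertices p ∣ < k

  KDClique : (k d : ℕ) → Subset (order G) → Set
  KDClique k d S = ∀ T → T ⊆ S → ∣ T ∣ ≡ k → Σ[ p ∈ ShortestPath≤ d ] T ⊆ vertices p

  KDColorable : (k d c : ℕ) → Set
  KDColorable k d c = Σ[ f ∈ (Vertex G → Fin c) ] ∀ i → KDIndependent k d (colorClass f i)

  Colorable : ℕ → Set
  Colorable c = Σ[ f ∈ (Vertex G → Fin c) ] ∀ u v → Adj u v → f u ≢ f v

  Clique : Subset (order G) → Set
  Clique S = ∀ u v → u ∈ S → v ∈ S → u ≢ v → Adj u v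

  IsLeastPositive : (ℕ → Set) → ℕ → Set
  IsLeastPositive P c = 1 ≤ c × P c × (∀ c′ → 1 ≤ c′ → P c′ → c ≤ c′)

  -- The graph is finite, so the supremum of the sizes is attained.
  IsMaxSize : (Subset (order G) → Set) → ℕ → Set
  IsMaxSize P w = (∃[ S ] P S × ∣ S ∣ ≡ w) × (∀ S → P S → ∣ S ∣ ≤ w)

  IsChromaticNumber : ℕ → Set
  IsChromaticNumber = IsLeastPositive Colorable

  IsCliqueNumber : ℕ → Set
  IsCliqueNumber = IsMaxSize Clique

  IsKDChromaticNumber : (k d : ℕ) → ℕ → Set
  IsKDChromaticNumber k d = IsLeastPositive (KDColorable k d)

  IsKDCliqueNumber : (k d : ℕ) → ℕ → Set
  IsKDCliqueNumber k d = IsMaxSize (KDClique k d)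

Perfect : Graph → Set₁
Perfect G = ∀ H → InducedSubgraph H G →
  ∃[ χ ] ∃[ ω ] IsChromaticNumber H χ × IsCliqueNumber H ω × χ ≡ ω

k∸1-nonZero : ∀ {k} → 2 ≤ k → NonZero (k ∸ 1)
k∸1-nonZero (s≤s (s≤s _)) = _

-- Defined only for 2 ≤ k ≤ d + 1; Agda fills in the two implicit arguments
-- when k and d are literals in this range.
KDPerfect : (k d : ℕ) {2≤k : True (2 ≤? k)} {k≤d+1 : True (k ≤? suc d)} → Graph → Set₁
KDPerfect k d {2≤k} G = ∀ H → InducedSubgraph H G →
  ∃[ χ ] ∃[ ω ] IsKDChromaticNumber H k d χ × IsKDCliqueNumber H k d ω ×
    + χ ≡ ceiling (_/_ (+ ω) (k ∸ 1) {{k∸1-nonZero (toWitness 2≤k)}})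

opposite-inject₁ : ∀ {n} (i : Fin n) → opposite (inject₁ i) ≡ suc (opposite i)
opposite-inject₁ zero    = refl
opposite-inject₁ (suc i) = cong inject₁ (opposite-inject₁ i)

opposite-fromℕ : ∀ n → opposite (fromℕ n) ≡ zero
opposite-fromℕ zero    = refl
opposite-fromℕ (suc n) = cong inject₁ (opposite-fromℕ n)

reverse : ∀ {G u v ℓ} → Path G u v ℓ → Path G v u ℓ
reverse {G} {ℓ = ℓ} p = record
  { vertex   = λ i → vertex (opposite i)
  ; start    = end
  ; end      = trans (cong vertex (opposite-fromℕ ℓ)) start
  ; adjacent = λ i → subst (λ j → Graph.Adj G (vertex j) (vertex (inject₁ (opposite i))))
      (sym (opposite-inject₁ i)) (Graph.symm G (adjacent (opposite i)))
  ; distinct = λ {i} {j} eq → trans (sym (opposite-involutive i))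
      (trans (cong opposite (distinct eq)) (opposite-involutive j))
  }
  where open Path p

square : Graph → Graph
square G = record
  { order    = order G
  ; nonempty = Graph.nonempty G
  ; Adj      = λ u v → u ≢ v × (∃[ m ] IsDistance G u v m × m ≤ 2)
  ; symm     = λ (u≢v , m , (p , least) , m≤2) →
      ≢-sym u≢v , m , (reverse p , λ q → least (reverse q)) , m≤2
  ; irrefl   = λ (v≢v , _) → v≢v refl
  }

{-# OPTIONS --safe #-}

-- The 9-cycle works.  Its square is not perfect: the vertices 0, 1, 3, 5, 7 induce a 5-cycle there.
-- But an induced subgraph H of the 9-cycle containing three consecutive vertices has a triangle in
-- its square, and labels modulo 3 colour it properly.  Without three consecutive vertices,
-- distance at most 2 in H means adjacency, and H is a matching plus isolated vertices; colouring a
-- vertex by whether its predecessor lies in H uses as many colours as the largest clique has vertices.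
module Submission where

open import Defs
open import Data.Bool using (true; false)
open import Data.Fin using (Fin; zero; suc; toℕ; fromℕ<; inject≤; #_)
open import Data.Fin.Properties using (_≟_; any?; all?; injective⇒≤; suc-injective; 0≢1+n; inject≤-injective)
open import Data.Fin.Subset using (Subset; _∈_; _⊆_; ∣_∣)
open import Data.Fin.Subset.Properties using (x∈p∩q⁺; x∈p∩q⁻)
open import Data.Integer using (+_)
open import Data.Nat using (ℕ; zero; suc; _+_; _≤_; z≤n; s≤s; >-nonZero⁻¹)
open import Data.Nat.DivMod using (_mod_)
open import Data.Nat.Properties using (≤-antisym; ≤-refl; <⇒≱)
open import Data.Product using (Σ-syntax; ∃-syntax; _×_; _,_; proj₁; proj₂)
open import Data.Rational.Unnormalised using (_/_; ceiling)
open import Data.Sum using (_⊎_; inj₁; inj₂; [_,_]; swap)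
open import Data.Vec using (Vec; []; _∷_; lookup; tabulate; here; there)
open import Data.Vec.Properties using (lookup⇒[]=; []=⇒lookup; lookup∘tabulate)
open import Data.Vec.Relation.Unary.All using ([]; _∷_)
open import Data.Vec.Relation.Unary.All.Properties using (lookup⁺)
open import Data.Vec.Relation.Unary.AllPairs using (AllPairs; []; _∷_) renaming (map to mapAllPairs)
open import Data.Vec.Relation.Unary.Unique.Propositional.Properties using (lookup-injective)
open import Function using (_∘_)
open import Function.Bundles using (Equivalence)
open import Function.Definitions using (Injective)
open import Function.Properties.Equivalence using () renaming (refl to ⇔-refl; sym to ⇔-sym)
open import Relation.Binary using (Rel; Symmetric) renaming (Decidable to Decidable₂)
open import Relation.Binary.PropositionalEquality using (_≡_; _≢_; refl; sym; trans; cong; subst; subst₂; ≢-sym)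
open import Relation.Nullary using (¬_; Dec; yes; no; does; contradiction)
open import Relation.Nullary.Decidable using (dec-true; map; map′; from-yes; ¬?; _×-dec_; _⊎-dec_; _→-dec_; decidable-stable)
open import Relation.Unary using (Pred; Decidable)

-- Finite subsets and their sizes

∈-tabulate⁺ : ∀ {n p} {P : Pred (Fin n) p} (P? : Decidable P) {x} →
  P x → x ∈ tabulate (does ∘ P?)
∈-tabulate⁺ P? {x} px =
  lookup⇒[]= x _ (trans (lookup∘tabulate (does ∘ P?) x) (dec-true (P? x) px))

∈-tabulate⁻ : ∀ {n p} {P : Pred (Fin n) p} (P? : Decidable P) {x} →
  x ∈ tabulate (does ∘ P?) → P x
∈-tabulate⁻ P? {x} x∈
  with P? x | trans (sym (lookup∘tabulate (does ∘ P?) x)) ([]=⇒lookup x∈)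
... | yes px | _ = px

lookup-AllPairs : ∀ {a ℓ} {A : Set a} {R : Rel A ℓ} {n} {xs : Vec A n} → Symmetric R →
  AllPairs R xs → ∀ {i j} → i ≢ j → R (lookup xs i) (lookup xs j)
lookup-AllPairs R-sym _          {zero}  {zero}  i≢j = contradiction refl i≢j
lookup-AllPairs R-sym (x~ ∷ _)   {zero}  {suc j} _   = lookup⁺ x~ j
lookup-AllPairs R-sym (x~ ∷ _)   {suc i} {zero}  _   = R-sym (lookup⁺ x~ i)
lookup-AllPairs R-sym (_  ∷ xs~) {suc i} {suc j} i≢j = lookup-AllPairs R-sym xs~ (i≢j ∘ cong suc)

-- Turns statements about sizes into statements about injections between `Fin` types. The size is a
-- parameter `c` rather than `∣ S ∣`, so that an enumeration can be transported along a known value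
-- of the size.
record Enumeration {n} (S : Subset n) (c : ℕ) : Set where
  field
    element   : Fin c → Fin n
    injective : Injective _≡_ _≡_ element
    member    : ∀ i → element i ∈ S
    complete  : ∀ {x} → x ∈ S → ∃[ i ] element i ≡ x

open Enumeration

enumerate : ∀ {n} (S : Subset n) → Enumeration S ∣ S ∣
enumerate [] = record
  { element = λ () ; injective = λ {} ; member = λ () ; complete = λ () }
enumerate (true ∷ S) = record
  { element   = λ { zero → zero ; (suc i) → suc (element E i) }
  ; injective = λ { {zero}  {zero}  _  → refl
                  ; {zero}  {suc _} ()
                  ; {suc _} {zero}  ()
                  ; {suc _} {suc _} eq → cong suc (injective E (suc-injective eq)) }
  ; member    = λ { zero → here ; (suc i) → there (member E i) }
  ; complete  = λ { here → zero , refl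
                  ; (there x∈) → let i , eq = complete E x∈ in suc i , cong suc eq }
  }
  where E = enumerate S
enumerate (false ∷ S) = record
  { element   = suc ∘ element E
  ; injective = injective E ∘ suc-injective
  ; member    = there ∘ member E
  ; complete  = λ { (there x∈) → let i , eq = complete E x∈ in i , cong suc eq }
  }
  where E = enumerate S

-- Each index of the first enumeration goes to the index of the same element in the second; this map
-- is injective because the element can be recovered from it.
⊆⇒≤ : ∀ {n c d} {S T : Subset n} → Enumeration S c → Enumeration T d → S ⊆ T → c ≤ d
⊆⇒≤ E F S⊆T = injective⇒≤ {f = proj₁ ∘ index} λ {i} {j} eq →
  injective E (trans (sym (proj₂ (index i))) (trans (cong (element F) eq) (proj₂ (index j))))
  where
  index : ∀ i → ∃[ k ] element F k ≡ element E i
  index i = complete F (S⊆T (member E i))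

image : ∀ {n c} → Vec (Fin n) c → Subset n
image xs = tabulate λ x → does (any? λ i → lookup xs i ≟ x)

∈-image⁺ : ∀ {n c} (xs : Vec (Fin n) c) i → lookup xs i ∈ image xs
∈-image⁺ xs i = ∈-tabulate⁺ (λ x → any? λ i → lookup xs i ≟ x) (i , refl)

∈-image⁻ : ∀ {n c} (xs : Vec (Fin n) c) {x} → x ∈ image xs → ∃[ i ] lookup xs i ≡ x
∈-image⁻ xs = ∈-tabulate⁻ (λ x → any? λ i → lookup xs i ≟ x)

enumerate-image : ∀ {n c} {xs : Vec (Fin n) c} → AllPairs _≢_ xs → Enumeration (image xs) c
enumerate-image {xs = xs} unique = record
  { element   = lookup xs
  ; injective = lookup-injective unique _ _
  ; member    = ∈-image⁺ xs
  ; complete  = ∈-image⁻ xs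
  }

∣image∣ : ∀ {n c} {xs : Vec (Fin n) c} → AllPairs _≢_ xs → ∣ image xs ∣ ≡ c
∣image∣ {xs = xs} unique = ≤-antisym
  (⊆⇒≤ (enumerate (image xs)) (enumerate-image unique) (λ x∈ → x∈))
  (⊆⇒≤ (enumerate-image unique) (enumerate (image xs)) (λ x∈ → x∈))

∣S∣≤1 : ∀ {n} {S : Subset n} → (∀ {x y} → x ∈ S → y ∈ S → x ≡ y) → ∣ S ∣ ≤ 1
∣S∣≤1 {S = S} equal = injective⇒≤ {f = λ _ → zero} λ {i} {j} _ →
  injective E (equal (member E i) (member E j))
  where E = enumerate S

2≤∣S∣ : ∀ {n} {S : Subset n} {x y} → x ≢ y → x ∈ S → y ∈ S → 2 ≤ ∣ S ∣
2≤∣S∣ {S = S} {x} {y} x≢y x∈ y∈ =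
  ⊆⇒≤ (enumerate-image ((x≢y ∷ []) ∷ [] ∷ [])) (enumerate S) pair⊆S
  where
  pair⊆S : image (x ∷ y ∷ []) ⊆ S
  pair⊆S z∈ with ∈-image⁻ (x ∷ y ∷ []) z∈
  ... | zero     , refl = x∈
  ... | suc zero , refl = y∈

-- A proper colouring is injective on a clique.
clique≤colors : ∀ (Q : Graph) {S c} → Clique Q S → Colorable Q c → ∣ S ∣ ≤ c
clique≤colors Q {S} clique (f , proper) = injective⇒≤ {f = f ∘ element E} λ {i} {j} eq →
  injective E (decidable-stable (element E i ≟ element E j) λ x≢y →
    proper _ _ (clique _ _ (member E i) (member E j) x≢y) eq)
  where E = enumerate S

-- 2,2-colourings and 2,2-cliques as colourings and cliques of the square

module Distance2 (G : Graph) (adj? : Decidable₂ (Graph.Adj G)) where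
  open Graph G using (Adj)

  -- A form of adjacency in the square that finite search decides. A vertex with a neighbour is near
  -- itself, so distinctness has to be supplied separately.
  Near : Vertex G → Vertex G → Set
  Near u v = Adj u v ⊎ ∃[ w ] Adj u w × Adj w v

  near? : Decidable₂ Near
  near? u v = adj? u v ⊎-dec any? λ w → adj? u w ×-dec adj? w v

  near-sym : Symmetric Near
  near-sym (inj₁ uv)            = inj₁ (Graph.symm G uv)
  near-sym (inj₂ (w , uw , wv)) = inj₂ (w , Graph.symm G wv , Graph.symm G uw)

  adj⇒≢ : ∀ {u v} → Adj u v → u ≢ v
  adj⇒≢ uv refl = Graph.irrefl G uv

  near⇒square : ∀ {u v} → u ≢ v → Near u v → Graph.Adj (square G) u v
  near⇒square {u} {v} u≢v near with adj? u v | near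
  -- Adjacency is tested first: vertices with a common neighbour may also be adjacent, and then
  -- their distance is 1 and not 2.
  ... | yes uv | _ = u≢v , 1 , (edge , least) , s≤s z≤n
    where
    edge : Path G u v 1
    edge = record
      { vertex   = lookup (u ∷ v ∷ [])
      ; start    = refl
      ; end      = refl
      ; adjacent = λ { zero → uv }
      ; distinct = lookup-injective ((u≢v ∷ []) ∷ [] ∷ []) _ _
      }
    least : ∀ {ℓ} → Path G u v ℓ → 1 ≤ ℓ
    least {zero}  p = contradiction (trans (sym (Path.start p)) (Path.end p)) u≢v
    least {suc _} p = s≤s z≤n
  ... | no ¬uv | inj₁ uv = contradiction uv ¬uv
  ... | no ¬uv | inj₂ (w , uw , wv) = u≢v , 2 , (cherry , least) , ≤-refl
    where
    cherry : Path G u v 2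
    cherry = record
      { vertex   = lookup (u ∷ w ∷ v ∷ [])
      ; start    = refl
      ; end      = refl
      ; adjacent = λ { zero → uw ; (suc zero) → wv }
      ; distinct = lookup-injective ((adj⇒≢ uw ∷ u≢v ∷ []) ∷ (adj⇒≢ wv ∷ []) ∷ [] ∷ []) _ _
      }
    least : ∀ {ℓ} → Path G u v ℓ → 2 ≤ ℓ
    least {zero}        p = contradiction (trans (sym (Path.start p)) (Path.end p)) u≢v
    least {suc zero}    p = contradiction (subst₂ Adj (Path.start p) (Path.end p) (Path.adjacent p zero)) ¬uv
    least {suc (suc _)} p = s≤s (s≤s z≤n)

  -- Stated for arbitrary positions, to serve both for the ends of a path that witnesses a distance
  -- and for any two vertices on a shortest path.
  path⇒near : ∀ {u v ℓ} (p : Path G u v ℓ) → ℓ ≤ 2 → ∀ i j → i ≢ j →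
    Near (Path.vertex p i) (Path.vertex p j)
  path⇒near p _ zero zero i≢j = contradiction refl i≢j
  path⇒near {ℓ = suc _} p _ zero (suc zero) _ = inj₁ (Path.adjacent p zero)
  path⇒near {ℓ = suc _} p _ (suc zero) zero _ = inj₁ (Graph.symm G (Path.adjacent p zero))
  path⇒near {ℓ = suc _} p _ (suc zero) (suc zero) i≢j = contradiction refl i≢j
  path⇒near {ℓ = suc (suc zero)} p _ zero (suc (suc zero)) _ =
    inj₂ (_ , Path.adjacent p zero , Path.adjacent p (suc zero))
  path⇒near {ℓ = suc (suc zero)} p _ (suc zero) (suc (suc zero)) _ = inj₁ (Path.adjacent p (suc zero))
  path⇒near {ℓ = suc (suc zero)} p _ (suc (suc zero)) zero _ =
    near-sym (inj₂ (_ , Path.adjacent p zero , Path.adjacent p (suc zero)))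
  path⇒near {ℓ = suc (suc zero)} p _ (suc (suc zero)) (suc zero) _ =
    inj₁ (Graph.symm G (Path.adjacent p (suc zero)))
  path⇒near {ℓ = suc (suc zero)} p _ (suc (suc zero)) (suc (suc zero)) i≢j = contradiction refl i≢j
  path⇒near {ℓ = suc (suc (suc _))} p (s≤s (s≤s ()))

  square⇒near : ∀ {u v} → Graph.Adj (square G) u v → Near u v
  square⇒near (u≢v , _ , (p , _) , m≤2) = subst₂ Near (Path.start p) (Path.end p)
    (path⇒near p m≤2 _ _ λ eq → u≢v (trans (sym (Path.start p)) (trans (cong (Path.vertex p) eq) (Path.end p))))

  squareAdj? : Decidable₂ (Graph.Adj (square G))
  squareAdj? u v = map′ (λ (u≢v , near) → near⇒square u≢v near) (λ uv → proj₁ uv , square⇒near uv)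
    (¬? (u ≟ v) ×-dec near? u v)

  onPath? : (p : ShortestPath≤ G 2) → Decidable (λ w → ∃[ i ] Path.vertex (ShortestPath≤.path p) i ≡ w)
  onPath? p w = any? λ i → Path.vertex (ShortestPath≤.path p) i ≟ w

  ∈-vertices⇒square : ∀ (p : ShortestPath≤ G 2) {u v} → u ∈ vertices p → v ∈ vertices p → u ≢ v →
    Graph.Adj (square G) u v
  ∈-vertices⇒square p u∈ v∈ u≢v with ∈-tabulate⁻ (onPath? p) u∈ | ∈-tabulate⁻ (onPath? p) v∈
  ... | i , refl | j , refl = near⇒square u≢v
    (path⇒near (ShortestPath≤.path p) (ShortestPath≤.bounded p) i j (u≢v ∘ cong _))

  -- The path that realises the distance is itself a shortest path of length at most 2, and it
  -- contains its ends.
  square⇒∈-vertices : ∀ {u v} → Graph.Adj (square G) u v →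
    Σ[ p ∈ ShortestPath≤ G 2 ] u ∈ vertices p × v ∈ vertices p
  square⇒∈-vertices (_ , m , (p , least) , m≤2) =
    sp , ∈-tabulate⁺ (onPath? sp) (_ , Path.start p) , ∈-tabulate⁺ (onPath? sp) (_ , Path.end p)
    where
    sp : ShortestPath≤ G 2
    sp = record { length = m ; path = p ; shortest = p , least ; bounded = m≤2 }

  -- Two equally coloured neighbours in the square would give a colour class with two vertices on
  -- one short shortest path.
  KDColorable⇒Colorable : ∀ {c} → KDColorable G 2 2 c → Colorable (square G) c
  KDColorable⇒Colorable (f , independent) = f , λ u v uv fu≡fv →
    let p , u∈p , v∈p = square⇒∈-vertices uv
        class? = λ w → f w ≟ f v
    in <⇒≱ (independent (f v) p)
         (2≤∣S∣ (proj₁ uv) (x∈p∩q⁺ (∈-tabulate⁺ class? fu≡fv , u∈p)) (x∈p∩q⁺ (∈-tabulate⁺ class? refl , v∈p)))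

  -- The vertices of a shortest path of length at most 2 form a clique of the square, so a proper
  -- colour class meets it at most once.
  Colorable⇒KDColorable : ∀ {c} → Colorable (square G) c → KDColorable G 2 2 c
  Colorable⇒KDColorable (f , proper) = f , λ i p → s≤s (∣S∣≤1 λ {x} {y} x∈ y∈ →
    let class? = λ w → f w ≟ i
        x∈i , x∈p = x∈p∩q⁻ (colorClass G f i) (vertices p) x∈
        y∈i , y∈p = x∈p∩q⁻ (colorClass G f i) (vertices p) y∈
    in decidable-stable (x ≟ y) λ x≢y → proper x y (∈-vertices⇒square p x∈p y∈p x≢y)
         (trans (∈-tabulate⁻ class? x∈i) (sym (∈-tabulate⁻ class? y∈i))))

  KDClique⇒Clique : ∀ {S} → KDClique G 2 2 S → Clique (square G) S
  KDClique⇒Clique {S} clique u v u∈ v∈ u≢v =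
    let p , pair⊆p = clique (image (u ∷ v ∷ [])) pair⊆S (∣image∣ ((u≢v ∷ []) ∷ [] ∷ []))
    in ∈-vertices⇒square p (pair⊆p (∈-image⁺ (u ∷ v ∷ []) zero)) (pair⊆p (∈-image⁺ (u ∷ v ∷ []) (suc zero))) u≢v
    where
    pair⊆S : image (u ∷ v ∷ []) ⊆ S
    pair⊆S z∈ with ∈-image⁻ (u ∷ v ∷ []) z∈
    ... | zero     , refl = u∈
    ... | suc zero , refl = v∈

  Clique⇒KDClique : ∀ {S} → Clique (square G) S → KDClique G 2 2 S
  Clique⇒KDClique clique T T⊆S ∣T∣≡2 =
    let p , x∈p , y∈p = square⇒∈-vertices
          (clique _ _ (T⊆S (member E zero)) (T⊆S (member E (suc zero))) (0≢1+n ∘ injective E))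
    -- The two enumerated elements exhaust `T`, so a path through both contains `T`.
    in p , λ z∈T → pair (complete E z∈T) x∈p y∈p
    where
    E : Enumeration T 2
    E = subst (Enumeration T) ∣T∣≡2 (enumerate T)
    pair : ∀ {z} {V : Subset (order G)} → ∃[ i ] element E i ≡ z →
      element E zero ∈ V → element E (suc zero) ∈ V → z ∈ V
    pair (zero     , refl) x∈ y∈ = x∈
    pair (suc zero , refl) x∈ y∈ = y∈

  -- A clique and a proper colouring of the square of the same size `c` certify each other as
  -- optimal, by `clique≤colors`.
  numbers : ∀ {c} → 1 ≤ c → (xs : Vec (Vertex G) c) → AllPairs (Graph.Adj (square G)) xs →
    Colorable (square G) c → IsKDChromaticNumber G 2 2 c × IsKDCliqueNumber G 2 2 c
  numbers 1≤c xs pairwise colorable =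
      (1≤c , Colorable⇒KDColorable colorable , λ _ _ kd →
        subst (_≤ _) size (clique≤colors (square G) clique (KDColorable⇒Colorable kd)))
    , ((image xs , Clique⇒KDClique clique , size) , λ S kd →
        clique≤colors (square G) (KDClique⇒Clique kd) colorable)
    where
    size : ∣ image xs ∣ ≡ _
    size = ∣image∣ (mapAllPairs proj₁ pairwise)
    clique : Clique (square G) (image xs)
    clique u v u∈ v∈ u≢v with ∈-image⁻ xs u∈ | ∈-image⁻ xs v∈
    ... | i , refl | j , refl = lookup-AllPairs (Graph.symm (square G)) pairwise (u≢v ∘ cong _)

-- The 9-cycle and its labels modulo 3

next : Fin 9 → Fin 9
next v = suc (toℕ v) mod 9

CycleAdj : Fin 9 → Fin 9 → Set
CycleAdj u v = next u ≡ v ⊎ next v ≡ u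

cycleAdj? : Decidable₂ CycleAdj
cycleAdj? u v = (next u ≟ v) ⊎-dec (next v ≟ u)

next≢ : ∀ v → next v ≢ v
next≢ = from-yes (all? λ v → ¬? (next v ≟ v))

next²≢ : ∀ v → next (next v) ≢ v
next²≢ = from-yes (all? λ v → ¬? (next (next v) ≟ v))

-- Adding 8 subtracts 1 modulo 9.
previous : Fin 9 → Fin 9
previous v = (8 + toℕ v) mod 9

next-injective : ∀ {u v} → next u ≡ next v → u ≡ v
next-injective {u} {v} eq = trans (sym (inverse u)) (trans (cong previous eq) (inverse v))
  where
  inverse : ∀ v → previous (next v) ≡ v
  inverse = from-yes (all? λ v → previous (next v) ≟ v)

C₉ : Graph
C₉ = record
  { order    = 9
  ; nonempty = _
  ; Adj      = CycleAdj
  ; symm     = swap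
  ; irrefl   = λ {v} → [ next≢ v , next≢ v ]
  }

residue : Fin 9 → Fin 3
residue v = toℕ v mod 3

-- Since 3 divides 9, the wrap from 8 to 0 also raises the residue by 1 modulo 3.
residue-next : ∀ v → residue v ≢ residue (next v)
residue-next = from-yes (all? λ v → ¬? (residue v ≟ residue (next v)))

residue-next² : ∀ v → residue v ≢ residue (next (next v))
residue-next² = from-yes (all? λ v → ¬? (residue v ≟ residue (next (next v))))

-- Induced subgraphs of the 9-cycle

module Subgraph (H : Graph) (H⊆C₉ : InducedSubgraph H C₉) where
  open InducedSubgraph H⊆C₉ using (embed; induced) renaming (injective to embed-injective)
  open Graph H using (Adj)

  adj? : Decidable₂ Adj
  adj? u v = map (⇔-sym (induced u v)) (cycleAdj? (embed u) (embed v))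

  open Distance2 H adj?

  Next : Vertex H → Vertex H → Set
  Next u v = next (embed u) ≡ embed v

  next? : Decidable₂ Next
  next? u v = next (embed u) ≟ embed v

  -- The forward half of adjacency in the square: colourings then need checking in one direction
  -- only. The middle vertex must lie in `H`, as distances are taken there.
  Step : Vertex H → Vertex H → Set
  Step u v = Next u v ⊎ ∃[ w ] Next u w × Next w v

  adj⇒next : ∀ {u v} → Adj u v → Next u v ⊎ Next v u
  adj⇒next = Equivalence.to (induced _ _)

  next⇒adj : ∀ {u v} → Next u v → Adj u v
  next⇒adj = Equivalence.from (induced _ _) ∘ inj₁

  square⇒step : ∀ {u v} → Graph.Adj (square H) u v → Step u v ⊎ Step v u
  square⇒step uv with square⇒near uv
  ... | inj₁ adj = [ inj₁ ∘ inj₁ , inj₂ ∘ inj₁ ] (adj⇒next adj)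
  ... | inj₂ (w , uw , wv) with adj⇒next uw | adj⇒next wv
  ... | inj₁ u→w | inj₁ w→v = inj₁ (inj₂ (w , u→w , w→v))
  ... | inj₂ w→u | inj₂ v→w = inj₂ (inj₂ (w , v→w , w→u))
  -- A walk that turns back at `w` returns to its start, so `u` and `v` would coincide: here they
  -- share a successor, below a predecessor.
  ... | inj₁ u→w | inj₂ v→w = contradiction (embed-injective (next-injective (trans u→w (sym v→w)))) (proj₁ uv)
  ... | inj₂ w→u | inj₁ w→v = contradiction (embed-injective (trans (sym w→u) w→v)) (proj₁ uv)

  next⇒square : ∀ {u v} → Next u v → Graph.Adj (square H) u v
  next⇒square u→v = near⇒square (adj⇒≢ (next⇒adj u→v)) (inj₁ (next⇒adj u→v))

  next²⇒square : ∀ {u w v} → Next u w → Next w v → Graph.Adj (square H) u v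
  next²⇒square {u} u→w w→v = near⇒square
    (λ { refl → next²≢ (embed u) (trans (cong next u→w) w→v) })
    (inj₂ (_ , next⇒adj u→w , next⇒adj w→v))

  colorable : ∀ {c} (f : Vertex H → Fin c) → (∀ {u v} → Step u v → f u ≢ f v) → Colorable (square H) c
  colorable f proper = f , λ u v uv → [ proper , ≢-sym ∘ proper ] (square⇒step uv)

  Consecutive₂ Consecutive₃ : Set
  Consecutive₂ = ∃[ u ] ∃[ v ] Next u v
  Consecutive₃ = ∃[ u ] ∃[ w ] ∃[ v ] Next u w × Next w v

  threeColorable : Colorable (square H) 3
  threeColorable = colorable (residue ∘ embed) proper
    where
    proper : ∀ {u v} → Step u v → residue (embed u) ≢ residue (embed v)
    proper {u} (inj₁ u→v) =
      subst (λ x → residue (embed u) ≢ residue x) u→v (residue-next (embed u))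
    proper {u} (inj₂ (_ , u→w , w→v)) =
      subst (λ x → residue (embed u) ≢ residue x) (trans (cong next u→w) w→v) (residue-next² (embed u))

  -- In a pair of consecutive vertices the second has a predecessor in `H`, while a predecessor of
  -- the first would complete three in a row.
  twoColorable : ¬ Consecutive₃ → Colorable (square H) 2
  twoColorable ¬three = colorable f proper
    where
    predecessor? : ∀ v → Dec (∃[ u ] Next u v)
    predecessor? v = any? λ u → next? u v
    f : Vertex H → Fin 2
    f v with predecessor? v
    ... | yes _ = suc zero
    ... | no  _ = zero
    proper : ∀ {u v} → Step u v → f u ≢ f v
    proper (inj₂ (w , u→w , w→v)) = contradiction (_ , w , _ , u→w , w→v) ¬three
    proper {u} {v} (inj₁ u→v) with predecessor? u | predecessor? v
    ... | yes (t , t→u) | _     = contradiction (t , u , v , t→u , u→v) ¬three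
    ... | no _          | yes _ = λ ()
    ... | no _          | no ¬p = contradiction (u , u→v) ¬p

  oneColorable : ¬ Consecutive₂ → Colorable (square H) 1
  oneColorable ¬two = colorable (λ _ → zero) λ
    { (inj₁ u→v)           → contradiction (_ , _ , u→v) ¬two
    ; (inj₂ (_ , u→w , _)) → contradiction (_ , _ , u→w) ¬two
    }

  someVertex : Vertex H
  someVertex = fromℕ< (>-nonZero⁻¹ (order H) {{Graph.nonempty H}})

  -- The cases are a run of three consecutive vertices, a run of two but not three, and none. The
  -- run, or a single vertex, is the clique matching the colouring; as `k ∸ 1` is 1, the ceiling
  -- changes nothing.
  kdNumbers : ∃[ χ ] ∃[ ω ] IsKDChromaticNumber H 2 2 χ × IsKDCliqueNumber H 2 2 ω ×
    + χ ≡ ceiling (+ ω / 1)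
  kdNumbers with any? (λ u → any? λ w → any? λ v → next? u w ×-dec next? w v)
  ... | yes (u , w , v , u→w , w→v) =
    let χ , ω = numbers (s≤s z≤n) (u ∷ w ∷ v ∷ [])
          ((next⇒square u→w ∷ next²⇒square u→w w→v ∷ []) ∷ (next⇒square w→v ∷ []) ∷ [] ∷ []) threeColorable
    in 3 , 3 , χ , ω , refl
  ... | no ¬three with any? (λ u → any? λ v → next? u v)
  ... | yes (u , v , u→v) =
    let χ , ω = numbers (s≤s z≤n) (u ∷ v ∷ []) ((next⇒square u→v ∷ []) ∷ [] ∷ []) (twoColorable ¬three)
    in 2 , 2 , χ , ω , refl
  ... | no ¬two =
    let χ , ω = numbers (s≤s z≤n) (someVertex ∷ []) ([] ∷ []) (oneColorable ¬two)
    in 1 , 1 , χ , ω , refl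

-- A 5-hole in the square of the 9-cycle

open Distance2 C₉ cycleAdj? using (squareAdj?)

-- The gaps around the cycle are 1, 2, 2, 2, 2. Two successive gaps add up to at least 3, so only
-- cyclically neighbouring entries are adjacent in the square.
hole : Fin 5 → Fin 9
hole = lookup (# 0 ∷ # 1 ∷ # 3 ∷ # 5 ∷ # 7 ∷ [])

-- Adjacency is pulled back along `hole`, which makes the subgraph induced by definition; that it
-- behaves like a 5-cycle is then settled by `holeAdj?`.
C₅ : Graph
C₅ = record
  { order    = 5
  ; nonempty = _
  ; Adj      = λ u v → Graph.Adj (square C₉) (hole u) (hole v)
  ; symm     = Graph.symm (square C₉)
  ; irrefl   = Graph.irrefl (square C₉)
  }

holeAdj? : Decidable₂ (Graph.Adj C₅)
holeAdj? u v = squareAdj? (hole u) (hole v)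

C₅-induced : InducedSubgraph C₅ (square C₉)
C₅-induced = record
  { embed     = hole
  ; injective = λ {u} {v} → from-yes (all? λ u → all? λ v → (hole u ≟ hole v) →-dec (u ≟ v)) u v
  ; induced   = λ _ _ → ⇔-refl
  }

C₅-triangleFree : ∀ u v w → ¬ (Graph.Adj C₅ u v × Graph.Adj C₅ v w × Graph.Adj C₅ u w)
C₅-triangleFree = from-yes (all? λ u → all? λ v → all? λ w →
  ¬? (holeAdj? u v ×-dec holeAdj? v w ×-dec holeAdj? u w))

≢-≢⇒≡ : ∀ {a b c : Fin 2} → a ≢ b → b ≢ c → a ≡ c
≢-≢⇒≡ {zero}     {_}        {zero}     _   _   = refl
≢-≢⇒≡ {suc zero} {_}        {suc zero} _   _   = refl
≢-≢⇒≡ {zero}     {zero}     {suc zero} a≢b _   = contradiction refl a≢b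
≢-≢⇒≡ {zero}     {suc zero} {suc zero} _   b≢c = contradiction refl b≢c
≢-≢⇒≡ {suc zero} {zero}     {zero}     _   b≢c = contradiction refl b≢c
≢-≢⇒≡ {suc zero} {suc zero} {zero}     a≢b _   = contradiction refl a≢b

-- Two colours must alternate along the cycle, so `v₀`, `v₂` and `v₄` agree, yet the edge from `v₄`
-- to `v₀` closes it.
C₅-not2Colorable : ¬ Colorable C₅ 2
C₅-not2Colorable (f , proper) =
  proper v₄ v₀ (from-yes (holeAdj? v₄ v₀)) (sym (trans
    (≢-≢⇒≡ (proper v₀ v₁ (from-yes (holeAdj? v₀ v₁))) (proper v₁ v₂ (from-yes (holeAdj? v₁ v₂))))
    (≢-≢⇒≡ (proper v₂ v₃ (from-yes (holeAdj? v₂ v₃))) (proper v₃ v₄ (from-yes (holeAdj? v₃ v₄))))))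
  where
  v₀ v₁ v₂ v₃ v₄ : Fin 5
  v₀ = # 0
  v₁ = # 1
  v₂ = # 2
  v₃ = # 3
  v₄ = # 4

C₅-clique≤2 : ∀ {S} → Clique C₅ S → ∣ S ∣ ≤ 2
-- Abstracting the size together with the enumeration lets the last case name three distinct
-- members, which would form a triangle.
C₅-clique≤2 {S} clique with ∣ S ∣ | enumerate S
... | zero              | _ = z≤n
... | suc zero          | _ = s≤s z≤n
... | suc (suc zero)    | _ = ≤-refl
... | suc (suc (suc _)) | E = contradiction
  (adjacent (λ ()) , adjacent (λ ()) , adjacent (λ ()))
  (C₅-triangleFree (element E zero) (element E (suc zero)) (element E (suc (suc zero))))
  where
  adjacent : ∀ {i j} → i ≢ j → Graph.Adj C₅ (element E i) (element E j)
  adjacent {i} {j} i≢j = clique _ _ (member E i) (member E j) (i≢j ∘ injective E)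

squareC₉-notPerfect : ¬ Perfect (square C₉)
squareC₉-notPerfect perfect with perfect C₅ C₅-induced
... | χ , .χ , (_ , (f , proper) , _) , ((S , clique , refl) , _) , refl =
  -- Perfection makes the number of colours equal to `∣ S ∣`, which is at most 2, so the colouring
  -- embeds into two colours.
  C₅-not2Colorable ((λ v → inject≤ (f v) ∣S∣≤2) , λ u v uv eq →
    proper u v uv (inject≤-injective _ _ _ _ eq))
  where
  ∣S∣≤2 : ∣ S ∣ ≤ 2
  ∣S∣≤2 = C₅-clique≤2 clique

proposition3p3 : Σ[ G ∈ Graph ] KDPerfect 2 2 G × ¬ Perfect (square G)
proposition3p3 = C₉ , Subgraph.kdNumbers , squareC₉-notPerfect
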